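{- Consider a sequence $\sigma$ of restricted operations applied to a dynamic set $S$ with function $f:S\to\mathbb{Z}_{\ge0}$, starting from $S=\emptyset$, while a set $H\subseteq S$ and a set $P\subseteq H$ are maintained by the rules described in the context. Let $h_t$ denote the $h$-index of $S$ and $f$ after the first $t$ operations, and let $q=\sum_{t:\,h_t\ge1} 1/h_t$. Then the total number of times an element is added to $P$ or removed from $P$ during $\sigma$ is $O(q)$ (with an absolute constant in the $O$).
   Context: The $h$-index of $S$ and $f$ is the largest $h\ge0$ such that some $h$-element subset of $S$ has all $f$-values at least $h$. Restricted operations: insert a new element $x$ with $f(x)=0$; delete an element $x$ with $f(x)=0$; increment $f(x)$ by $1$; decrement $f(x)$ by $1$ (when $f(x)\ge1$). Initially $H=P=\emptyset$. Maintenance of $H$ (with $h=|H|$ before the operation): insertions and deletions of elements with $f=0$ leave $H$ unchanged. On an increment of $f(x)$: if $x\in H$ or the new value $f(x)\le h$, $H$ is unchanged; otherwise ($x\notin H$ and new $f(x)=h+1$), if some $y\in H$ has $f(y)=h$ then one such $y$ (chosen arbitrarily) is removed from $H$ and $x$ is added, and if no such $y$ exists then $x$ is added to $H$ (so $|H|$ becomes $h+1$). On a decrement of $f(x)$: if $x\notin H$ or the new value $f(x)\ge h$, $H$ is unchanged; otherwise ($x\in H$, new $f(x)=h-1$), $x$ is removed from $H$, and if some $z\notin H$ has $f(z)=h$ then one such $z$ (chosen arbitrarily) is added to $H$, otherwise $|H|$ becomes $h-1$. (These rules keep $|H|$ equal to the $h$-index, $f(x)\ge|H|$ for all $x\in H$,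 and every $x$ with $f(x)>|H|$ in $H$.) Maintenance of $P$: whenever an element is removed from $H$ it is also removed from $P$ (if present); after each operation, every $x\in H\setminus P$ with $f(x)\ge 2|H|$ is added to $P$; no other changes are made to $P$. -}

module Defs where

open import Data.Integer using (+_)
open import Data.List using (List; []; _∷_; [_]; _++_; length; filter; map; foldr)
open import Data.List.Membership.Propositional using (_∈_; _∉_)
import Data.List.Membership.DecPropositional as DecMembership
open import Data.List.Relation.Binary.Subset.Propositional using (_⊆_)
open import Data.List.Relation.Unary.All using (All)
open import Data.List.Relation.Unary.Unique.Propositional using (Unique)
open import Data.Nat using (ℕ; zero; suc; pred; _+_; _*_; _≤_; _<_; _≤?_)
open import Data.Product using (_×_; ∃-syntax)
open import Data.Rational as ℚ using (ℚ; 0ℚ)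
open import Data.Sum using (_⊎_)
open import Relation.Binary.Definitions using (DecidableEquality)
open import Relation.Binary.PropositionalEquality using (_≡_; _≢_)
open import Relation.Nullary using (yes; no)
open import Relation.Nullary.Decidable using (¬?; _×-dec_)

-- Finite sets are duplicate-free lists; cardinality is `length`.

module _ {A : Set} where

  HasLevel : List A → (A → ℕ) → ℕ → Set
  HasLevel S f h =
    ∃[ T ] (Unique T × T ⊆ S × length T ≡ h × All (λ x → h ≤ f x) T)

  IsHIndex : List A → (A → ℕ) → ℕ → Set
  IsHIndex S f h = HasLevel S f h × (∀ k → HasLevel S f k → k ≤ h)

data Op (A : Set) : Set where
  insert delete increment decrement : A → Op A

module Maintenance {A : Set} (_≟_ : DecidableEquality A) where

  open DecMembership _≟_ using (_∈?_; _∉?_)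

  _∖_ : List A → List A → List A
  X ∖ Y = filter (_∉? Y) X

  _[_↦_] : (A → ℕ) → A → ℕ → (A → ℕ)
  (f [ x ↦ v ]) y with y ≟ x
  ... | yes _ = v
  ... | no  _ = f y

  -- Only the values of f on S are meaningful.
  record State : Set where
    constructor state
    field
      S : List A
      f : A → ℕ
      H : List A
      P : List A

  start : State
  start = state [] (λ _ → 0) [] []

  data Valid (S : List A) (f : A → ℕ) : Op A → Set where
    insert    : ∀ {x} → x ∉ S → Valid S f (insert x)
    delete    : ∀ {x} → x ∈ S → f x ≡ 0 → Valid S f (delete x)
    increment : ∀ {x} → x ∈ S → Valid S f (increment x)
    decrement : ∀ {x} → x ∈ S → 1 ≤ f x → Valid S f (decrement x)

  newS : List A → Op A → List A
  newS S (insert x)    = x ∷ S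
  newS S (delete x)    = S ∖ [ x ]
  newS S (increment _) = S
  newS S (decrement _) = S

  newf : (A → ℕ) → Op A → (A → ℕ)
  newf f (insert x)    = f [ x ↦ 0 ]
  newf f (delete _)    = f
  newf f (increment x) = f [ x ↦ suc (f x) ]
  newf f (decrement x) = f [ x ↦ pred (f x) ]

  -- HRule S f H op out into: when op has just produced S and f, the rules
  -- allow the elements of `out` to leave H and those of `into` to join it.
  -- H is the set before the operation, so h = length H.  The arbitrary
  -- choices of y and z make this a relation rather than a function.
  data HRule (S : List A) (f : A → ℕ) (H : List A) :
             Op A → List A → List A → Set where
    insert     : ∀ {x} → HRule S f H (insert x) [] []
    delete     : ∀ {x} → HRule S f H (delete x) [] []
    inc-keep   : ∀ {x} → x ∈ H ⊎ f x ≤ length H →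
                 HRule S f H (increment x) [] []
    inc-swap   : ∀ {x y} → x ∉ H → length H < f x →
                 y ∈ H → f y ≡ length H →
                 HRule S f H (increment x) [ y ] [ x ]
    inc-grow   : ∀ {x} → x ∉ H → length H < f x →
                 (∀ y → y ∈ H → f y ≢ length H) →
                 HRule S f H (increment x) [] [ x ]
    dec-keep   : ∀ {x} → x ∉ H ⊎ length H ≤ f x →
                 HRule S f H (decrement x) [] []
    dec-swap   : ∀ {x z} → x ∈ H → f x < length H →
                 z ∈ S → z ∉ H → f z ≡ length H →
                 HRule S f H (decrement x) [ x ] [ z ]
    dec-shrink : ∀ {x} → x ∈ H → f x < length H →
                 (∀ z → z ∈ S → z ∉ H → f z ≢ length H) →
                 HRule S f H (decrement x) [ x ] []

  record Step (s : State) (op : Op A) : Set where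
    open State s
    field
      valid    : Valid S f op
      out into : List A
      rule     : HRule (newS S op) (newf f op) H op out into

    H′ : List A
    H′ = into ++ (H ∖ out)

    removedP : List A
    removedP = filter (_∈? P) out

    keptP : List A
    keptP = P ∖ out

    addedP : List A
    addedP = filter (λ x → (x ∉? keptP) ×-dec (2 * length H′ ≤? newf f op x)) H′

    target : State
    target = state (newS S op) (newf f op) H′ (addedP ++ keptP)

    changes : ℕ
    changes = length addedP + length removedP

  data Run (s : State) : List (Op A) → Set where
    []  : Run s []
    _∷_ : ∀ {op σ} (step : Step s op) → Run (Step.target step) σ →
          Run s (op ∷ σ)

  -- The states after the first t operations, t = 0, …, length σ.
  states : ∀ {s σ} → Run s σ → List State
  states {s} []           = s ∷ []
  states {s} (step ∷ run) = s ∷ states run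

  totalChanges : ∀ {s σ} → Run s σ → ℕ
  totalChanges []           = 0
  totalChanges (step ∷ run) = Step.changes step + totalChanges run

  HIndexOf : State → ℕ → Set
  HIndexOf s = IsHIndex (State.S s) (State.f s)

-- Indices with h = 0 are left out of the sum.
reciprocal : ℕ → ℚ
reciprocal zero    = 0ℚ
reciprocal (suc k) = + 1 ℚ./ suc k

sumReciprocals : List ℕ → ℚ
sumReciprocals hs = foldr ℚ._+_ 0ℚ (map reciprocal hs)

{-# OPTIONS --safe #-}
module Submission where

-- Amortise while h stays close to a remembered base m, with tolerance d between m / 8 and m / 4.
-- As long as |h − m| ≤ d, an element joins P only when f ≥ 2h ≥ m + 2d and leaves it only when
-- f ≤ h ≤ m + d, so each change of P is paid by d unit changes of f between m + d and m + 2d.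
-- If h drifts to m + d (or m − d), then the sum over S of f clipped to [m, m + d] (or to
-- [m − d, m]) has moved by at least d², which takes at least d² operations; dividing by d, they
-- pay for restarting the potential at the new base, which costs at most h ≤ 9d.
-- For h < 4 every operation may be charged a constant.  Each operation thus has amortised cost
-- at most 19 / d ≤ 171 / h.

open import Data.Empty using (⊥-elim)
open import Data.Integer as ℤ using (+_)
import Data.Integer.Properties as ℤ
open import Data.List using (List; []; _∷_; [_]; _++_; length; filter; map)
open import Data.List.Membership.Propositional using (_∈_; _∉_)
open import Data.List.Membership.Propositional.Properties using (∈-filter⁺; ∈-filter⁻; ∈-++⁻; ∈-++⁺ˡ; ∈-++⁺ʳ)
import Data.List.Membership.DecPropositional as DecMembership
open import Data.List.Properties using (filter-all; filter-notAll; length-filter; length-++)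
open import Data.List.Relation.Binary.Pointwise using (Pointwise; []; _∷_)
open import Data.List.Relation.Binary.Subset.Propositional using (_⊆_)
open import Data.List.Relation.Unary.All as All using ([]; _∷_)
open import Data.List.Relation.Unary.AllPairs using ([]; _∷_)
open import Data.List.Relation.Unary.Any as Any using (here; there)
open import Data.List.Relation.Unary.Unique.Propositional using (Unique)
import Data.List.Relation.Unary.Unique.Propositional.Properties as Unique
open import Data.Nat as ℕ using (ℕ; zero; suc; pred; _+_; _∸_; _⊓_; _<_; z≤n; s≤s; _≤?_; _<?_)
open import Data.Nat.ListAction using (sum)
import Data.Nat.Solver as ℕSolver
open import Data.Nat.DivMod as DivMod using (_%_; m≡m%n+[m/n]*n; m%n<n; m/n*n≤m; m≥n⇒m/n>0)
open import Data.Nat.Properties as ℕ hiding (_≟_)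
open import Data.Product using (∃-syntax; _×_; _,_; proj₁; proj₂)
open import Data.Rational as ℚ using (ℚ; 0ℚ; 1ℚ; _/_; _*_; _≤_)
import Data.Rational.Properties as ℚ
open import Data.Rational.Solver using (module +-*-Solver)
import Data.Rational.Unnormalised as ℚᵘ
import Data.Rational.Unnormalised.Properties as ℚᵘ
open import Data.Sum using (_⊎_; inj₁; inj₂)
open import Relation.Binary.Definitions using (DecidableEquality)
open import Relation.Binary.PropositionalEquality using (_≡_; _≢_; refl; sym; trans; cong; cong₂; subst)
open import Relation.Nullary using (¬_; yes; no; Dec; _×-dec_)
open import Relation.Unary using (Pred; Decidable)
open import Defs

-- Fractions of natural numbers.

-- Unfolding ι on an open argument exposes a gcd computation that makes conversion checking blow up.
opaque
  ι : ℕ → ℚ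
  ι n = + n / 1

  ι-def : ∀ n → ι n ≡ + n / 1
  ι-def n = refl

  -- Moves identities to unnormalised rationals, where equality is cross-multiplication of integers.
  toℚᵘ-/ : ∀ n k → ℚ.toℚᵘ (+ n / suc k) ℚᵘ.≃ ℚᵘ.mkℚᵘ (+ n) k
  toℚᵘ-/ n k = ℚ.toℚᵘ-fromℚᵘ (ℚᵘ.mkℚᵘ (+ n) k)

  ι-+ : ∀ m n → ι (m ℕ.+ n) ≡ ι m ℚ.+ ι n
  ι-+ m n = ℚ.toℚᵘ-injective (ℚᵘ.≃-trans (toℚᵘ-/ (m ℕ.+ n) 0) (ℚᵘ.≃-sym
    (ℚᵘ.≃-trans (ℚ.toℚᵘ-homo-+ (ι m) (ι n)) (ℚᵘ.≃-trans (ℚᵘ.+-cong (toℚᵘ-/ m 0) (toℚᵘ-/ n 0))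
    (ℚᵘ.*≡* (cong (λ i → i ℤ.* + 1) (cong₂ ℤ._+_ (ℤ.*-identityʳ (+ m)) (ℤ.*-identityʳ (+ n)))))))))

  ι-* : ∀ m n → ι (m ℕ.* n) ≡ ι m * ι n
  ι-* m n = ℚ.toℚᵘ-injective (ℚᵘ.≃-trans (toℚᵘ-/ (m ℕ.* n) 0) (ℚᵘ.≃-sym
    (ℚᵘ.≃-trans (ℚ.toℚᵘ-homo-* (ι m) (ι n)) (ℚᵘ.≃-trans (ℚᵘ.*-cong (toℚᵘ-/ m 0) (toℚᵘ-/ n 0))
    (ℚᵘ.*≡* (cong (λ i → i ℤ.* + 1) (sym (ℤ.pos-* m n))))))))

  ι-mono : ∀ {m n} → m ℕ.≤ n → ι m ≤ ι n
  ι-mono {m} {n} m≤n = ℚ.toℚᵘ-cancel-≤ (ℚᵘ.≤-respˡ-≃ (ℚᵘ.≃-sym (toℚᵘ-/ m 0)) (ℚᵘ.≤-respʳ-≃ (ℚᵘ.≃-sym (toℚᵘ-/ n 0))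
    (ℚᵘ.*≤* (ℤ.*-monoʳ-≤-nonNeg (+ 1) (ℤ.+≤+ m≤n)))))

  ι-reciprocal : ∀ {d} → 0 < d → ι d * reciprocal d ≡ 1ℚ
  ι-reciprocal {suc k} _ = ℚ.toℚᵘ-injective
    (ℚᵘ.≃-trans (ℚ.toℚᵘ-homo-* (ι (suc k)) (reciprocal (suc k))) (ℚᵘ.≃-trans (ℚᵘ.*-cong (toℚᵘ-/ (suc k) 0) (toℚᵘ-/ 1 k))
    (ℚᵘ.*≡* (trans (ℤ.*-identityʳ _) (trans (ℤ.*-identityʳ (+ suc k)) (sym (trans (ℤ.*-identityˡ _) (ℤ.*-identityˡ _))))))))

reciprocal-nonNeg : ∀ d → ℚ.NonNegative (reciprocal d)
reciprocal-nonNeg zero    = _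
reciprocal-nonNeg (suc k) = ℚ.normalize-nonNeg 1 (suc k)

-- Division through `reciprocal`, so `n per 0` is 0, in line with the terms left out of the sum q.
_per_ : ℕ → ℕ → ℚ
n per d = ι n * reciprocal d

per-mono : ∀ {m n} d → m ℕ.≤ n → m per d ≤ n per d
per-mono d m≤n = ℚ.*-monoʳ-≤-nonNeg (reciprocal d) {{reciprocal-nonNeg d}} (ι-mono m≤n)

per-+ : ∀ m n d → (m ℕ.+ n) per d ≡ m per d ℚ.+ n per d
per-+ m n d = trans (cong (_* reciprocal d) (ι-+ m n)) (ℚ.*-distribʳ-+ (reciprocal d) (ι m) (ι n))

0-per : ∀ d → 0 per d ≡ 0ℚ
0-per d = trans (cong (_* reciprocal d) (ι-def 0)) (ℚ.*-zeroˡ (reciprocal d))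

per-cancel : ∀ {d} c → 0 < d → (d ℕ.* c) per d ≡ ι c
per-cancel {d} c 0<d = trans (cong (_* reciprocal d) (ι-* d c))
  (trans (solve 3 (λ a b r → a :* b :* r := b :* (a :* r)) refl (ι d) (ι c) (reciprocal d))
  (trans (cong (ι c *_) (ι-reciprocal 0<d)) (ℚ.*-identityʳ (ι c))))
  where open +-*-Solver

per-≤ : ∀ {m n c d} → 0 < c → 0 < d → m ℕ.* d ℕ.≤ n ℕ.* c → m per c ≤ n per d
per-≤ {m} {n} {c} {d} 0<c 0<d le = begin
  ι m * reciprocal c                              ≡⟨ ℚ.*-identityʳ _ ⟨
  (m per c) * 1ℚ                                  ≡⟨ cong ((m per c) *_) (ι-reciprocal 0<d) ⟨
  (m per c) * (ι d * reciprocal d)                ≡⟨ solve 4 (λ x r y s → (x :* r) :* (y :* s) := ((x :* y) :* r) :* s) refl (ι m) (reciprocal c) (ι d) (reciprocal d) ⟩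
  ((ι m * ι d) * reciprocal c) * reciprocal d     ≡⟨ cong (λ q → (q * reciprocal c) * reciprocal d) (ι-* m d) ⟨
  (m ℕ.* d) per c * reciprocal d                  ≤⟨ ℚ.*-monoʳ-≤-nonNeg (reciprocal d) {{reciprocal-nonNeg d}} (per-mono c le) ⟩
  (n ℕ.* c) per c * reciprocal d                  ≡⟨ cong (λ k → k per c * reciprocal d) (ℕ.*-comm n c) ⟩
  (c ℕ.* n) per c * reciprocal d                  ≡⟨ cong (_* reciprocal d) (per-cancel n 0<c) ⟩
  n per d                                         ∎
  where
    open ℚ.≤-Reasoning
    open +-*-Solver

-- Dividing by `d` turns the integer accounting of one operation into rationals: `k` units cost
-- `k / d`, at most `C / h`. At `h = 0` the budget `C per h` is 0, so there the charge has to
-- vanish.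
amortised-per : ∀ C {c d k h N X} → 0 < d → d ℕ.* c + X ℕ.≤ N + k →
                k ℕ.* h ℕ.≤ C ℕ.* d → (h ≡ 0 → k ≡ 0) →
                ι c ℚ.+ X per d ≤ N per d ℚ.+ C per h
amortised-per C {c} {d} {k} {h} {N} {X} 0<d le charge no-charge = begin
  ι c ℚ.+ X per d                  ≡⟨ cong (ℚ._+ X per d) (per-cancel c 0<d) ⟨
  (d ℕ.* c) per d ℚ.+ X per d      ≡⟨ per-+ (d ℕ.* c) X d ⟨
  (d ℕ.* c + X) per d              ≤⟨ per-mono d le ⟩
  (N + k) per d                    ≡⟨ per-+ N k d ⟩
  N per d ℚ.+ k per d              ≤⟨ ℚ.+-monoʳ-≤ (N per d) (charged h charge no-charge) ⟩
  N per d ℚ.+ C per h              ∎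
  where
    open ℚ.≤-Reasoning
    charged : ∀ h → k ℕ.* h ℕ.≤ C ℕ.* d → (h ≡ 0 → k ≡ 0) → k per d ≤ C per h
    charged zero _ k≡0 = ℚ.≤-reflexive (trans (cong (_per d) (k≡0 refl)) (trans (0-per d) (sym (ℚ.*-zeroʳ (ι C)))))
    charged (suc h) le _ = per-≤ {k} {C} 0<d (s≤s z≤n) le

-- Induction step over a run: `i` counts the changes now and `t` those later; `n` and `x` are the
-- potentials before and after the operation, `y` is that of the phase carried on, `r` and `l` are
-- the present and later reciprocals.
telescope : ∀ (c i t y x n r l : ℚ) → t ≤ y ℚ.+ c * l → y ≤ x → i ℚ.+ x ≤ n ℚ.+ c * r →
            i ℚ.+ t ≤ n ℚ.+ c * (r ℚ.+ l)
telescope c i t y x n r l t≤ y≤x i+x≤ = begin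
  i ℚ.+ t                       ≤⟨ ℚ.+-monoʳ-≤ i t≤ ⟩
  i ℚ.+ (y ℚ.+ c * l)           ≤⟨ ℚ.+-monoʳ-≤ i (ℚ.+-monoˡ-≤ (c * l) y≤x) ⟩
  i ℚ.+ (x ℚ.+ c * l)           ≡⟨ ℚ.+-assoc i x (c * l) ⟨
  (i ℚ.+ x) ℚ.+ c * l           ≤⟨ ℚ.+-monoˡ-≤ (c * l) i+x≤ ⟩
  (n ℚ.+ c * r) ℚ.+ c * l       ≡⟨ ℚ.+-assoc n (c * r) (c * l) ⟩
  n ℚ.+ (c * r ℚ.+ c * l)       ≡⟨ cong (n ℚ.+_) (ℚ.*-distribˡ-+ c r l) ⟨
  n ℚ.+ c * (r ℚ.+ l)           ∎
  where open ℚ.≤-Reasoning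

-- Both sides are compared with `h`: a fresh phase starts with at most `h`, an exhausted one holds
-- at least `h`. So one can replace the other although their denominators differ.
per-full : ∀ {N₁ d₁ h d X} → 0 < d₁ → 0 < d → N₁ ℕ.≤ d₁ ℕ.* h → d ℕ.* h ℕ.≤ X → N₁ per d₁ ≤ X per d
per-full {N₁} {d₁} {h} {d} {X} 0<d₁ 0<d N₁≤ ≤X = begin
  N₁ per d₁            ≤⟨ per-mono d₁ N₁≤ ⟩
  (d₁ ℕ.* h) per d₁    ≡⟨ per-cancel h 0<d₁ ⟩
  ι h                  ≡⟨ per-cancel h 0<d ⟨
  (d ℕ.* h) per d      ≤⟨ per-mono d ≤X ⟩
  X per d              ∎
  where open ℚ.≤-Reasoning

per-nonNeg : ∀ N d → 0ℚ ≤ N per d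
per-nonNeg N d = ℚ.≤-trans (ℚ.≤-reflexive (sym (0-per d))) (per-mono {0} {N} d z≤n)

-- Sums of weights over lists.

sumOver : {A : Set} → (A → ℕ) → List A → ℕ
sumOver g xs = sum (map g xs)

-- Two one-sided bounds: subtracting from a constant, as in `flipIf` and `fall`, exchanges them.
within1 : ℕ → ℕ → Set
within1 a b = a ℕ.≤ suc b × b ℕ.≤ suc a

≡⇒within1 : ∀ {a b} → a ≡ b → within1 a b
≡⇒within1 refl = n≤1+n _ , n≤1+n _

module _ {A : Set} where

  sumOver-cong : ∀ {g g′ : A → ℕ} xs → (∀ {x} → x ∈ xs → g′ x ≡ g x) →
                 sumOver g′ xs ≡ sumOver g xs
  sumOver-cong []       eq = refl
  sumOver-cong (x ∷ xs) eq = cong₂ _+_ (eq (here refl)) (sumOver-cong xs (λ i → eq (there i)))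

  sumOver-filter : ∀ {p} {Q : Pred A p} (Q? : Decidable Q) {g : A → ℕ} xs →
                   (∀ {x} → x ∈ xs → ¬ Q x → g x ≡ 0) →
                   sumOver g (filter Q? xs) ≡ sumOver g xs
  sumOver-filter Q? [] z = refl
  sumOver-filter Q? {g} (x ∷ xs) z with Q? x
  ... | yes q =
    cong (_ ℕ.+_) (sumOver-filter Q? xs (λ i → z (there i)))
  ... | no ¬q rewrite z (here refl) ¬q =
    sumOver-filter Q? xs (λ i → z (there i))

  sumOver-drop : ∀ {p} {Q : Pred A p} (Q? : Decidable Q) {g g′ : A → ℕ} d xs →
                 (∀ {x} → x ∈ xs → g′ x ℕ.≤ g x) →
                 (∀ {x} → x ∈ xs → Q x → g′ x + d ℕ.≤ g x) →
                 sumOver g′ xs + d ℕ.* length (filter Q? xs) ℕ.≤ sumOver g xs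
  sumOver-drop Q? d [] le drop = ≤-reflexive (*-zeroʳ d)
  sumOver-drop Q? {g} {g′} d (x ∷ xs) le drop with Q? x
  ... | yes q = begin
    (g′ x + s′) + d ℕ.* suc k  ≡⟨ cong ((g′ x + s′) ℕ.+_) (*-suc d k) ⟩
    (g′ x + s′) + (d + d ℕ.* k)  ≡⟨ solve 4 (λ a b c e → (a :+ b) :+ (c :+ e) := (a :+ c) :+ (b :+ e)) refl (g′ x) s′ d _ ⟩
    (g′ x + d) + (s′ + d ℕ.* k)  ≤⟨ +-mono-≤ (drop (here refl) q) ih ⟩
    g x + sumOver g xs ∎
    where
      open ≤-Reasoning
      open ℕSolver.+-*-Solver using (solve; con; _:+_; _:*_; _:=_)
      s′ = sumOver g′ xs
      k = length (filter Q? xs)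
      ih = sumOver-drop Q? {g} {g′} d xs (λ i → le (there i)) (λ i → drop (there i))
  ... | no ¬q =
    ≤-trans (≤-reflexive (+-assoc (g′ x) _ _))
            (+-mono-≤ (le (here refl)) (sumOver-drop Q? d xs (λ i → le (there i)) (λ i → drop (there i))))

  sumOver-support : ∀ {p} {Q : Pred A p} (Q? : Decidable Q) {g : A → ℕ} d xs →
                    (∀ x → g x ℕ.≤ d) → (∀ {x} → x ∈ xs → ¬ Q x → g x ≡ 0) →
                    sumOver g xs ℕ.≤ d ℕ.* length (filter Q? xs)
  sumOver-support Q? d [] le z = z≤n
  sumOver-support Q? {g} d (x ∷ xs) le z with Q? x
  ... | yes q =
    ≤-trans (+-mono-≤ (le x) (sumOver-support Q? d xs le (λ i → z (there i))))
            (≤-reflexive (sym (*-suc d _)))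
  ... | no ¬q rewrite z (here refl) ¬q =
    sumOver-support Q? d xs le (λ i → z (there i))

-- Values clipped to `[a, a + d]`, measured from `a`, and their reflection.

clip : ℕ → ℕ → ℕ → ℕ
clip a d n = (n ∸ a) ⊓ d

clip-≤ : ∀ a d n → clip a d n ℕ.≤ d
clip-≤ a d n = m⊓n≤n (n ∸ a) d

clip-low : ∀ a d {n} → n ℕ.≤ a → clip a d n ≡ 0
clip-low a d n≤a rewrite m≤n⇒m∸n≡0 n≤a = refl

clip-high : ∀ a d {n} → a + d ℕ.≤ n → clip a d n ≡ d
clip-high a d {n} a+d≤n = m≥n⇒m⊓n≡n (m+n≤o⇒m≤o∸n d (≤-trans (≤-reflexive (+-comm d a)) a+d≤n))

∸-within1ˡ : ∀ {a b} c → a ℕ.≤ suc b → a ∸ c ℕ.≤ suc (b ∸ c)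
∸-within1ˡ {a} {b} c a≤ = m≤n+o⇒m∸n≤o a c
  (≤-trans a≤ (≤-trans (s≤s (m≤n+m∸n b c)) (≤-reflexive (sym (+-suc c (b ∸ c))))))

∸-within1ʳ : ∀ {a b} c → b ℕ.≤ suc a → c ∸ a ℕ.≤ suc (c ∸ b)
∸-within1ʳ {a} {b} c b≤ = m≤n+o⇒m∸n≤o c a
  (≤-trans (m≤n+m∸n c b) (≤-trans (+-monoˡ-≤ (c ∸ b) b≤) (≤-reflexive (sym (+-suc a (c ∸ b))))))

clip-smooth : ∀ a d n → within1 (clip a d (suc n)) (clip a d n)
clip-smooth a d n =
    ⊓-mono-≤ (∸-within1ˡ a (≤-refl {suc n})) (n≤1+n d)
  , m≤n⇒m≤1+n (⊓-monoˡ-≤ d (∸-monoˡ-≤ a (n≤1+n n)))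

-- For a clipped value `c`, a non-member of `P` has made progress `c` towards joining, a member
-- `d ∸ c` towards leaving. At the end of the way the weight is `d`, and switching sides resets it
-- to 0.
flipIf : ∀ {X : Set} → ℕ → Dec X → ℕ → ℕ
flipIf d (yes _) c = d ∸ c
flipIf d (no _)  c = c

flipIf-yes : ∀ {X : Set} d (p : Dec X) c → X → flipIf d p c ≡ d ∸ c
flipIf-yes d (yes _) c x = refl
flipIf-yes d (no ¬x) c x = ⊥-elim (¬x x)

flipIf-no : ∀ {X : Set} d (p : Dec X) c → ¬ X → flipIf d p c ≡ c
flipIf-no d (yes x) c ¬x = ⊥-elim (¬x x)
flipIf-no d (no _)  c ¬x = refl

flipIf-within1 : ∀ {X : Set} d (p : Dec X) {b c} → within1 b c → within1 (flipIf d p b) (flipIf d p c)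
flipIf-within1 d (yes _) (le , ge) = ∸-within1ʳ d ge , ∸-within1ʳ d le
flipIf-within1 d (no _)  w         = w

module Amortisation {A : Set} (_≟_ : DecidableEquality A) where

  open Maintenance _≟_
  open DecMembership _≟_ using (_∈?_; _∉?_)

  -- Finite sets as duplicate-free lists.

  ∈-∖⁺ : ∀ {x X Y} → x ∈ X → x ∉ Y → x ∈ X ∖ Y
  ∈-∖⁺ = ∈-filter⁺ (_∉? _)

  ∈-∖⁻ : ∀ {x} X Y → x ∈ X ∖ Y → x ∈ X × x ∉ Y
  ∈-∖⁻ X Y = ∈-filter⁻ (_∉? Y)

  ∖-[] : ∀ X → X ∖ [] ≡ X
  ∖-[] X = filter-all (_∉? []) {xs = X} (All.tabulate (λ _ ()))

  ≢⇒∉[] : ∀ {x y : A} → x ≢ y → x ∉ [ y ]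
  ≢⇒∉[] x≢y (here x≡y) = x≢y x≡y

  Unique-∷ : ∀ {x : A} {xs} → x ∉ xs → Unique xs → Unique (x ∷ xs)
  Unique-∷ x∉ u = All.tabulate (λ { i refl → x∉ i }) ∷ u

  length-∖-< : ∀ {x X} → x ∈ X → length (X ∖ [ x ]) < length X
  length-∖-< {x} {X} i =
    filter-notAll (_∉? [ x ]) X (Any.map (λ { refl ∉ → ∉ (here refl) }) i)

  -- Pigeonhole by induction on `X`: deleting its head from `Y` shortens `Y` and keeps the tail of
  -- `X` inside, since the head does not recur.
  Unique-⊆⇒length≤ : ∀ {X Y : List A} → Unique X → X ⊆ Y → length X ℕ.≤ length Y
  Unique-⊆⇒length≤ [] _ = z≤n
  Unique-⊆⇒length≤ (x∉ ∷ u) X⊆Y =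
    <-≤-trans (s≤s (Unique-⊆⇒length≤ u (λ i → ∈-∖⁺ (X⊆Y (there i)) (≢⇒∉[] λ { refl → All.lookup x∉ i refl }))))
              (length-∖-< (X⊆Y (here refl)))

  length-∖ : ∀ {x X} → Unique X → x ∈ X → suc (length (X ∖ [ x ])) ≡ length X
  length-∖ {x} {X} u i = ≤-antisym (length-∖-< i) (Unique-⊆⇒length≤ u X⊆)
    where
      X⊆ : X ⊆ x ∷ (X ∖ [ x ])
      X⊆ {y} j with y ≟ x
      ... | yes refl = here refl
      ... | no y≢x   = there (∈-∖⁺ j (≢⇒∉[] y≢x))

  -- As `L` has no duplicates, at least `length L` entries of `X` lie in `L`, and each loses `d`.
  sumOver-drop-⊆ : ∀ {g g′ : A → ℕ} d {L X} → Unique L → L ⊆ X →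
                   (∀ {x} → x ∈ X → g′ x ℕ.≤ g x) →
                   (∀ {x} → x ∈ L → g′ x + d ℕ.≤ g x) →
                   sumOver g′ X + d ℕ.* length L ℕ.≤ sumOver g X
  sumOver-drop-⊆ d {L} {X} u L⊆X le drop =
    ≤-trans (+-monoʳ-≤ _ (*-monoʳ-≤ d (Unique-⊆⇒length≤ u (λ i → ∈-filter⁺ (_∈? L) (L⊆X i) i))))
            (sumOver-drop (_∈? L) d X le (λ _ → drop))

  sumOver-support-⊆ : ∀ {g : A → ℕ} d {L X} → Unique X →
                      (∀ x → g x ℕ.≤ d) → (∀ {x} → x ∈ X → x ∉ L → g x ≡ 0) →
                      sumOver g X ℕ.≤ d ℕ.* length L
  sumOver-support-⊆ d {L} {X} u le z =
    ≤-trans (sumOver-support (_∈? L) d X le z)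
            (*-monoʳ-≤ d (Unique-⊆⇒length≤ (Unique.filter⁺ (_∈? L) u) (λ i → proj₂ (∈-filter⁻ (_∈? L) {xs = X} i))))

  -- `x` occurs at most once in `X`, so its unit of growth is not multiplied.
  sumOver-local : ∀ {g g′ : A → ℕ} x {X} → Unique X →
                  (∀ y → y ≢ x → g′ y ≡ g y) → g′ x ℕ.≤ suc (g x) →
                  sumOver g′ X ℕ.≤ suc (sumOver g X)
  sumOver-local x {[]} u eq le = z≤n
  sumOver-local x {y ∷ X} (y∉ ∷ u) eq le with y ≟ x
  ... | yes refl = +-mono-≤ le (≤-reflexive (sumOver-cong X (λ i → eq _ (λ { refl → All.lookup y∉ i refl }))))
  ... | no y≢x   = ≤-trans (+-mono-≤ (≤-reflexive (eq y y≢x)) (sumOver-local x u eq le))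
                           (≤-reflexive (+-suc _ _))

  -- Effect of one operation on a sum of weights.

  update-same : ∀ f x v → (f [ x ↦ v ]) x ≡ v
  update-same f x v with x ≟ x
  ... | yes _  = refl
  ... | no x≢x = ⊥-elim (x≢x refl)

  update-other : ∀ f {x y} v → y ≢ x → (f [ x ↦ v ]) y ≡ f y
  update-other f {x} {y} v y≢x with y ≟ x
  ... | yes y≡x = ⊥-elim (y≢x y≡x)
  ... | no _    = refl

  module Weight (w : A → ℕ → ℕ) (smooth : ∀ x n → within1 (w x (suc n)) (w x n)) where

    weight : List A → (A → ℕ) → ℕ
    weight S f = sumOver (λ x → w x (f x)) S

    update-within1 : ∀ {S} f x v → Unique S → within1 (w x v) (w x (f x)) →
                     within1 (weight S (f [ x ↦ v ])) (weight S f)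
    update-within1 f x v u (le , ge) =
        sumOver-local x u (λ y y≢x → cong (w y) (update-other f v y≢x))
          (subst (λ n → w x n ℕ.≤ _) (sym (update-same f x v)) le)
      , sumOver-local x u (λ y y≢x → cong (w y) (sym (update-other f v y≢x)))
          (subst (λ n → _ ℕ.≤ suc (w x n)) (sym (update-same f x v)) ge)

    -- The premise `x ∈ S → f x ≡ 0` covers both an inserted element, which is not in `S`, and a
    -- deleted one. It cannot be dropped for the membership weight, which at value 0 is `d` on
    -- members of `P`.
    op-within1 : ∀ {S f op} → Unique S → Valid S f op →
                 (∀ {x} → (x ∈ S → f x ≡ 0) → w x 0 ≡ 0) →
                 within1 (weight (newS S op) (newf f op)) (weight S f)
    op-within1 {S} {f} u (insert {x} x∉S) w0 = ≡⇒within1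
      (cong₂ _+_ (trans (cong (w x) (update-same f x 0)) (w0 (λ i → ⊥-elim (x∉S i))))
                 (sumOver-cong S (λ {y} i → cong (w y) (update-other f 0 (λ { refl → x∉S i })))))
    op-within1 {S} {f} u (delete {x} x∈S fx≡0) w0 = ≡⇒within1 (sumOver-filter (_∉? [ x ]) S vanish)
      where
        vanish : ∀ {y} → y ∈ S → ¬ (y ∉ [ x ]) → w y (f y) ≡ 0
        vanish {y} _ ¬∉ with y ≟ x
        ... | yes refl = trans (cong (w x) fx≡0) (w0 (λ _ → fx≡0))
        ... | no y≢x   = ⊥-elim (¬∉ (≢⇒∉[] y≢x))
    op-within1 {f = f} u (increment {x} _) w0 = update-within1 f x _ u (smooth x (f x))
    op-within1 {f = f} u (decrement {x} _ 1≤) w0 = update-within1 f x _ u (lower (f x) 1≤)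
      where
        lower : ∀ n → 1 ℕ.≤ n → within1 (w x (pred n)) (w x n)
        lower (suc n) _ = proj₂ (smooth x n) , proj₁ (smooth x n)

  -- The invariant of `H` and its preservation.

  record HInvariant (S : List A) (f : A → ℕ) (H : List A) : Set where
    field
      uniqueS : Unique S
      uniqueH : Unique H
      H⊆S     : H ⊆ S
      H-high  : ∀ {x} → x ∈ H → length H ℕ.≤ f x
      high-H  : ∀ {x} → x ∈ S → length H < f x → x ∈ H

  -- A member would give `1 ≤ length H ≤ f x`.
  zero∉H : ∀ {S f H x} → HInvariant S f H → f x ≡ 0 → x ∉ H
  zero∉H inv fx≡0 x∈H with ≤-trans (∈⇒length>0 x∈H) (≤-trans (HInvariant.H-high inv x∈H) (≤-reflexive fx≡0))
    where
      ∈⇒length>0 : ∀ {x X} → x ∈ X → 0 < length X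
      ∈⇒length>0 {X = _ ∷ _} _ = s≤s z≤n
  ... | ()

  -- `H` itself witnesses level `length H`. If `h` were larger, the witness `T` of level `h` would
  -- lie strictly above the threshold, hence inside `H`, so `h ≤ length H` after all.
  length-isHIndex : ∀ {S f H h} → HInvariant S f H → IsHIndex S f h → length H ≡ h
  length-isHIndex {S} {f} {H} {h} inv ((T , uT , T⊆S , |T|≡h , high) , maximal) =
    ≤-antisym (maximal (length H) (H , uniqueH , H⊆S , refl , All.tabulate H-high)) (≮⇒≥ h≯)
    where
      open HInvariant inv
      h≯ : ¬ (length H < h)
      h≯ H<h = <⇒≱ H<h (≤-trans (≤-reflexive (sym |T|≡h))
        (Unique-⊆⇒length≤ uT (λ i → high-H (T⊆S i) (<-≤-trans H<h (All.lookup high i)))))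

  start-HInvariant : HInvariant [] (λ _ → 0) []
  start-HInvariant = record
    { uniqueS = [] ; uniqueH = [] ; H⊆S = λ () ; H-high = λ () ; high-H = λ () }

  newS-unique : ∀ {S f op} → Unique S → Valid S f op → Unique (newS S op)
  newS-unique u (insert x∉S)    = Unique-∷ x∉S u
  newS-unique u (delete {x} _ _) = Unique.filter⁺ (_∉? [ x ]) u
  newS-unique u (increment _)   = u
  newS-unique u (decrement _ _) = u

  H⊆newS : ∀ {S f H op} → HInvariant S f H → Valid S f op → H ⊆ newS S op
  H⊆newS inv (insert _) i        = there (HInvariant.H⊆S inv i)
  H⊆newS inv (delete _ fx≡0) i   = ∈-∖⁺ (HInvariant.H⊆S inv i) (≢⇒∉[] λ { refl → zero∉H inv fx≡0 i })
  H⊆newS inv (increment _) i     = HInvariant.H⊆S inv i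
  H⊆newS inv (decrement _ _) i   = HInvariant.H⊆S inv i

  size-within1 : ∀ {S f H op out into} → Unique H → HRule S f H op out into →
                 within1 (length (into ++ (H ∖ out))) (length H)
  size-within1 {H = H} u insert             = ≡⇒within1 (cong length (∖-[] H))
  size-within1 {H = H} u delete             = ≡⇒within1 (cong length (∖-[] H))
  size-within1 {H = H} u (inc-keep _)       = ≡⇒within1 (cong length (∖-[] H))
  size-within1 u (inc-swap _ _ y∈H _)       = ≡⇒within1 (length-∖ u y∈H)
  size-within1 {H = H} u (inc-grow _ _ _) rewrite ∖-[] H =
    ≤-refl , ≤-trans (n≤1+n _) (n≤1+n _)
  size-within1 {H = H} u (dec-keep _)       = ≡⇒within1 (cong length (∖-[] H))
  size-within1 u (dec-swap x∈H _ _ _ _)     = ≡⇒within1 (length-∖ u x∈H)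
  size-within1 u (dec-shrink x∈H _ _) rewrite sym (length-∖ u x∈H) =
    ≤-trans (n≤1+n _) (n≤1+n _) , ≤-refl

  out-⊆ : ∀ {S f H op out into} → HRule S f H op out into → out ⊆ H
  out-⊆ (inc-swap _ _ y∈H _) (here refl)   = y∈H
  out-⊆ (dec-swap x∈H _ _ _ _) (here refl) = x∈H
  out-⊆ (dec-shrink x∈H _ _) (here refl)   = x∈H

  -- Here `f` is the function after the operation and `H` the set before it. While
  -- `length H ≤ m + d`, an element leaving `P` thus has clipped value 0.
  out-low : ∀ {S f H op out into x} → HRule S f H op out into → x ∈ out → f x ℕ.≤ length H
  out-low (inc-swap _ _ _ fy≡) (here refl)    = ≤-reflexive fy≡
  out-low (dec-swap _ fx< _ _ _) (here refl)  = <⇒≤ fx<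
  out-low (dec-shrink _ fx< _) (here refl)    = <⇒≤ fx<

  out-unique : ∀ {S f H op out into} → HRule S f H op out into → Unique out
  out-unique insert               = []
  out-unique delete               = []
  out-unique (inc-keep _)         = []
  out-unique (inc-swap _ _ _ _)   = [] ∷ []
  out-unique (inc-grow _ _ _)     = []
  out-unique (dec-keep _)         = []
  out-unique (dec-swap _ _ _ _ _) = [] ∷ []
  out-unique (dec-shrink _ _ _)   = [] ∷ []

  into-∉H : ∀ {S f H op out into x} → HRule S f H op out into → x ∈ into → x ∉ H
  into-∉H (inc-swap x∉H _ _ _) (here refl)   = x∉H
  into-∉H (inc-grow x∉H _ _) (here refl)     = x∉H
  into-∉H (dec-swap _ _ _ z∉H _) (here refl) = z∉H

  into-unique : ∀ {S f H op out into} → HRule S f H op out into → Unique into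
  into-unique insert               = []
  into-unique delete               = []
  into-unique (inc-keep _)         = []
  into-unique (inc-swap _ _ _ _)   = [] ∷ []
  into-unique (inc-grow _ _ _)     = [] ∷ []
  into-unique (dec-keep _)         = []
  into-unique (dec-swap _ _ _ _ _) = [] ∷ []
  into-unique (dec-shrink _ _ _)   = []

  into-⊆ : ∀ {S f H op out into} → Valid S f op → HRule (newS S op) (newf f op) H op out into →
           into ⊆ newS S op
  into-⊆ (increment x∈S) (inc-swap _ _ _ _) (here refl)     = x∈S
  into-⊆ (increment x∈S) (inc-grow _ _ _) (here refl)       = x∈S
  into-⊆ (decrement _ _) (dec-swap _ _ z∈S _ _) (here refl) = z∈S

  module _ {S f H} (inv : HInvariant S f H) where

    open HInvariant inv

    -- The threshold rises only in `inc-grow`, and then no member sits at the old one. In a swap the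
    -- newcomer has value at least the old size, and a member decremented below the threshold
    -- leaves.
    step-high : ∀ {op out into x} → Valid S f op →
                HRule (newS S op) (newf f op) H op out into →
                x ∈ into ++ (H ∖ out) → length (into ++ (H ∖ out)) ℕ.≤ newf f op x
    step-high {x = y} (insert {x} x∉S) insert i rewrite ∖-[] H with y ≟ x
    ... | yes refl = ⊥-elim (x∉S (H⊆S i))
    ... | no _     = H-high i
    step-high v delete i rewrite ∖-[] H = H-high i
    step-high {x = y} v (inc-keep {x} _) i rewrite ∖-[] H with y ≟ x
    ... | yes refl = m≤n⇒m≤1+n (H-high i)
    ... | no _     = H-high i
    step-high v (inc-swap x∉H H<fx y∈H fy) (here refl) = ≤-trans (≤-reflexive (length-∖ uniqueH y∈H)) (<⇒≤ H<fx)
    step-high {x = z} v (inc-swap {x} {y} x∉H H<fx y∈H fy) (there i)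
      rewrite length-∖ uniqueH y∈H | update-other f {x} {z} (suc (f x)) (λ { refl → x∉H (proj₁ (∈-∖⁻ H [ y ] i)) })
      = H-high (proj₁ (∈-∖⁻ H [ y ] i))
    step-high v (inc-grow x∉H H<fx none) (here refl) rewrite ∖-[] H = H<fx
    step-high {x = z} v (inc-grow {x} x∉H H<fx none) (there i)
      rewrite ∖-[] H =
      ≤∧≢⇒< (subst (length H ℕ.≤_) (sym (update-other f {x} {z} (suc (f x)) (λ { refl → x∉H i }))) (H-high i))
            (λ eq → none z i (sym eq))
    step-high {x = y} v (dec-keep {x} keep) i rewrite ∖-[] H = kept keep
      where
        kept : x ∉ H ⊎ length H ℕ.≤ (f [ x ↦ pred (f x) ]) x → length H ℕ.≤ (f [ x ↦ pred (f x) ]) y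
        kept k with y ≟ x
        kept (inj₁ x∉H) | yes refl = ⊥-elim (x∉H i)
        kept (inj₂ le)  | yes refl = subst (length H ℕ.≤_) (update-same f x _) le
        kept _          | no _     = H-high i
    step-high v (dec-swap x∈H _ _ _ fz) (here refl) = ≤-reflexive (trans (length-∖ uniqueH x∈H) (sym fz))
    step-high {x = y} v (dec-swap {x} x∈H _ _ _ fz) (there i)
      rewrite length-∖ uniqueH x∈H | update-other f {x} {y} (pred (f x)) (λ { refl → proj₂ (∈-∖⁻ H [ x ] i) (here refl) })
      = H-high (proj₁ (∈-∖⁻ H [ x ] i))
    step-high {x = y} v (dec-shrink {x} x∈H _ _) i
      rewrite update-other f {x} {y} (pred (f x)) (λ { refl → proj₂ (∈-∖⁻ H [ x ] i) (here refl) })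
      = ≤-trans (length-filter (_∉? [ x ]) H) (H-high (proj₁ (∈-∖⁻ H [ x ] i)))

    -- Elements leaving in a swap do not exceed the threshold. When it falls, in `dec-shrink`, every
    -- element at its old level is already in `H`.
    high-step : ∀ {op out into x} → Valid S f op →
                HRule (newS S op) (newf f op) H op out into →
                x ∈ newS S op → length (into ++ (H ∖ out)) < newf f op x → x ∈ into ++ (H ∖ out)
    high-step {x = y} (insert {x} x∉S) insert i lt rewrite ∖-[] H with y ≟ x | i
    ... | no y≢x | here y≡x  = ⊥-elim (y≢x y≡x)
    ... | no y≢x | there y∈S = high-H y∈S lt
    high-step (delete {x} _ _) delete i lt rewrite ∖-[] H = high-H (proj₁ (∈-∖⁻ S [ x ] i)) lt
    high-step {x = y} v (inc-keep {x} keep) i lt rewrite ∖-[] H = kept keep lt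
      where
        kept : x ∈ H ⊎ (f [ x ↦ suc (f x) ]) x ℕ.≤ length H → length H < (f [ x ↦ suc (f x) ]) y → y ∈ H
        kept k lt with y ≟ x
        kept (inj₁ x∈H) lt | yes refl = x∈H
        kept (inj₂ le)  lt | yes refl = ⊥-elim (<⇒≱ lt (subst (ℕ._≤ length H) (update-same f x _) le))
        kept _          lt | no _     = high-H i lt
    high-step {x = z} v (inc-swap {x} {y} x∉H H<fx y∈H fy) i lt rewrite length-∖ uniqueH y∈H with z ≟ x
    ... | yes refl = here refl
    -- The removed `y` sits exactly at the threshold, so `z`, being above it, is not `y`.
    ... | no z≢x   = there (∈-∖⁺ (high-H i lt) (≢⇒∉[] λ { refl → <⇒≢ lt (trans (sym fy) (update-other f _ z≢x)) }))
    high-step {x = z} v (inc-grow {x} x∉H H<fx none) i lt rewrite ∖-[] H with z ≟ x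
    ... | yes refl = here refl
    ... | no z≢x   = there (high-H i (<-trans (n<1+n _) lt))
    high-step {x = y} v (dec-keep {x} keep) i lt rewrite ∖-[] H with y ≟ x
    ... | yes refl = high-H i (≤-trans lt pred[n]≤n)
    ... | no _     = high-H i lt
    high-step {x = y} v (dec-swap {x} {z} x∈H fx< z∈S z∉H fz) i lt rewrite length-∖ uniqueH x∈H with y ≟ x
    ... | yes refl = ⊥-elim (<-asym lt (subst (_< length H) (update-same f x _) fx<))
    ... | no y≢x   = there (∈-∖⁺ (high-H i lt) (≢⇒∉[] y≢x))
    high-step {x = y} v (dec-shrink {x} x∈H fx< none) i lt = shrunk (y ∈? H)
      where
        H≤fy : length H ℕ.≤ (f [ x ↦ pred (f x) ]) y
        H≤fy = ≤-trans (≤-reflexive (sym (length-∖ uniqueH x∈H))) lt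
        y≢x : y ≢ x
        y≢x refl = <⇒≱ fx< H≤fy
        shrunk : Dec (y ∈ H) → y ∈ H ∖ [ x ]
        shrunk (yes y∈H) = ∈-∖⁺ y∈H (≢⇒∉[] y≢x)
        -- Outside `H`, the value `length H` is excluded by `none`, and a larger one would have put
        -- `y` in `H` before.
        shrunk (no y∉H)  = ⊥-elim (y∉H (high-H i (subst (length H <_) (update-other f _ y≢x)
          (≤∧≢⇒< H≤fy (λ eq → none y i y∉H (sym eq))))))

    step-HInvariant : ∀ {op out into} → Valid S f op →
                      HRule (newS S op) (newf f op) H op out into →
                      HInvariant (newS S op) (newf f op) (into ++ (H ∖ out))
    step-HInvariant {op} {out} {into} v r = record
      { uniqueS = newS-unique uniqueS v
      ; uniqueH = Unique.++⁺ (into-unique r) (Unique.filter⁺ (_∉? out) uniqueH)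
                    (λ (i , j) → into-∉H r i (proj₁ (∈-∖⁻ H out j)))
      ; H⊆S     = λ i → H′⊆ (∈-++⁻ into i)
      ; H-high  = step-high v r
      ; high-H  = high-step v r
      }
      where
        H′⊆ : ∀ {x} → x ∈ into ⊎ x ∈ H ∖ out → x ∈ newS S op
        H′⊆ (inj₁ i) = into-⊆ v r i
        H′⊆ (inj₂ j) = H⊆newS inv v (proj₁ (∈-∖⁻ H out j))

  -- The invariant of `P` and the elements joining and leaving it.

  record Invariant (s : State) : Set where
    open State s
    field
      onH     : HInvariant S f H
      uniqueP : Unique P
      P⊆H     : P ⊆ H
    open HInvariant onH public

  start-Invariant : Invariant start
  start-Invariant = record { onH = start-HInvariant ; uniqueP = [] ; P⊆H = λ () }

  module _ {s op} (inv : Invariant s) (step : Step s op) where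

    open State s
    open Invariant inv
    open Step step

    target-onH : HInvariant (newS S op) (newf f op) H′
    target-onH = step-HInvariant onH valid rule

    added? : Decidable (λ x → x ∉ keptP × 2 ℕ.* length H′ ℕ.≤ newf f op x)
    added? x = (x ∉? keptP) ×-dec (2 ℕ.* length H′ ≤? newf f op x)

    addedP-⊆ : addedP ⊆ H′
    addedP-⊆ i = proj₁ (∈-filter⁻ added? {xs = H′} i)

    addedP-unique : Unique addedP
    addedP-unique = Unique.filter⁺ added? (HInvariant.uniqueH target-onH)

    keptP-unique : Unique keptP
    keptP-unique = Unique.filter⁺ (_∉? out) uniqueP

    removedP-unique : Unique removedP
    removedP-unique = Unique.filter⁺ (_∈? P) (out-unique rule)

    removedP-⊆ : removedP ⊆ newS S op
    removedP-⊆ i = H⊆newS onH valid (out-⊆ rule (proj₁ (∈-filter⁻ (_∈? P) {xs = out} i)))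

    target-Invariant : Invariant target
    target-Invariant = record
      { onH     = target-onH
      ; uniqueP = Unique.++⁺ addedP-unique keptP-unique
                    (λ (i , j) → proj₁ (proj₂ (∈-filter⁻ added? {xs = H′} i)) j)
      ; P⊆H     = λ i → P′⊆ (∈-++⁻ addedP i)
      }
      where
        P′⊆ : ∀ {x} → x ∈ addedP ⊎ x ∈ keptP → x ∈ H′
        P′⊆ (inj₁ i) = addedP-⊆ i
        P′⊆ (inj₂ j) = let x∈P , x∉out = ∈-∖⁻ P out j in
          ∈-++⁺ʳ into (∈-∖⁺ (P⊆H x∈P) x∉out)

    -- Crude accounting, for small `H`: removed and kept elements are disjoint parts of the old `P`,
    -- and each of the at most `length H′` added ones counts twice, as a change and in the new `P`.
    changes-≤ : changes + length (State.P target) ℕ.≤ length P + 2 ℕ.* length H′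
    changes-≤ = begin
      (a + r) + length (addedP ++ keptP) ≡⟨ cong ((a + r) ℕ.+_) (length-++ addedP) ⟩
      (a + r) + (a + k)                  ≡⟨ solve 3 (λ a r k → (a :+ r) :+ (a :+ k) := (r :+ k) :+ con 2 :* a) refl a r k ⟩
      (r + k) + 2 ℕ.* a                  ≤⟨ +-mono-≤ r+k≤ (*-monoʳ-≤ 2 (length-filter added? H′)) ⟩
      length P + 2 ℕ.* length H′         ∎
      where
        open ≤-Reasoning
        open ℕSolver.+-*-Solver using (solve; con; _:+_; _:*_; _:=_)
        a = length addedP
        r = length removedP
        k = length keptP
        ⊆P : ∀ {x} → x ∈ removedP ⊎ x ∈ keptP → x ∈ P
        ⊆P (inj₁ i) = proj₂ (∈-filter⁻ (_∈? P) {xs = out} i)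
        ⊆P (inj₂ j) = proj₁ (∈-∖⁻ P out j)
        r+k≤ : r + k ℕ.≤ length P
        r+k≤ = ≤-trans (≤-reflexive (sym (length-++ removedP)))
          (Unique-⊆⇒length≤
            (Unique.++⁺ removedP-unique keptP-unique
              (λ (i , j) → proj₂ (∈-∖⁻ P out j) (proj₁ (∈-filter⁻ (_∈? P) {xs = out} i))))
            (λ i → ⊆P (∈-++⁻ removedP i)))

  -- The potential for base `m` and tolerance `d`.

  module Potential (m d : ℕ) where

    module Clip (a : ℕ) = Weight (λ _ → clip a d) (λ _ → clip-smooth a d)

    clipped : ℕ → State → ℕ
    clipped a s = Clip.weight a (State.S s) (State.f s)

    -- `P` is an argument apart from the state, so that a change of `f` and a change of `P` can be
    -- measured one after the other.
    pWeight : List A → A → ℕ → ℕ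
    pWeight P x n = flipIf d (x ∈? P) (clip (m + d) d n)

    module PWeight (P : List A) =
      Weight (pWeight P) (λ x n → flipIf-within1 d (x ∈? P) (clip-smooth (m + d) d n))

    -- The reference value is `m * d`: when `length H` is `m`, the sum clipped to `[m, m + d]` is at
    -- most, and the sum clipped to `[m - d, m]` at least, `m * d`. With truncated subtraction both
    -- drift terms then start at 0.
    rise fall membership potential : State → ℕ
    rise s = clipped m s ∸ m ℕ.* d
    fall s = m ℕ.* d ∸ clipped (m ∸ d) s
    membership s = PWeight.weight (State.P s) (State.S s) (State.f s)
    potential s = 9 ℕ.* (rise s + fall s) + membership s

    module _ {s} (inv : Invariant s) where

      open State s
      open Invariant inv

      -- Elements outside `H` have values at most `length H ≤ a` and clip to 0.
      clipped-≤ : ∀ {a} → length H ℕ.≤ a → clipped a s ℕ.≤ d ℕ.* length H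
      clipped-≤ {a} H≤a = sumOver-support-⊆ d uniqueS (λ x → clip-≤ a d (f x))
        (λ i x∉H → clip-low a d (≤-trans (≮⇒≥ (λ lt → x∉H (high-H i lt))) H≤a))

      clipped-≥ : ∀ {a} → a + d ℕ.≤ length H → d ℕ.* length H ℕ.≤ clipped a s
      -- With the zero weight as `g′`, each member of `H` counts as a drop of `d`.
      clipped-≥ {a} a+d≤H = ≤-trans (m≤n+m _ (sumOver (λ _ → 0) S))
        (sumOver-drop-⊆ {g′ = λ _ → 0} d uniqueH H⊆S (λ _ → z≤n)
          (λ i → ≤-reflexive (sym (clip-high a d (≤-trans a+d≤H (H-high i))))))

      membership-≤ : length H ℕ.≤ m + d → membership s ℕ.≤ d ℕ.* length H
      membership-≤ H≤ = sumOver-support-⊆ d uniqueS (λ x → bound (x ∈? P) (clip-≤ (m + d) d (f x)))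
        (λ {x} i x∉H → trans (flipIf-no d (x ∈? P) _ (λ x∈P → x∉H (P⊆H x∈P)))
          (clip-low (m + d) d (≤-trans (≮⇒≥ (λ lt → x∉H (high-H i lt))) H≤)))
        where
          bound : ∀ {X : Set} (p : Dec X) {c} → c ℕ.≤ d → flipIf d p c ℕ.≤ d
          bound (yes _) {c} _ = m∸n≤m d c
          bound (no _)  c≤d   = c≤d

      fresh-potential : length H ≡ m → d ℕ.≤ m → potential s ℕ.≤ d ℕ.* length H
      fresh-potential refl d≤m
        rewrite m≤n⇒m∸n≡0 (≤-trans (clipped-≤ ≤-refl) (≤-reflexive (*-comm d m)))
              | m≤n⇒m∸n≡0 (≤-trans (≤-reflexive (*-comm m d)) (clipped-≥ (≤-reflexive (m∸n+n≡m d≤m))))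
        = membership-≤ (m≤m+n m d)

      -- At least `m + d` members now contribute `d` each, which exceeds the reference `m * d` by
      -- `d * d`.
      rise-full : m + d ℕ.≤ length H → d ℕ.* d ℕ.≤ rise s
      rise-full le = m+n≤o⇒m≤o∸n (d ℕ.* d) (begin
        d ℕ.* d + m ℕ.* d  ≡⟨ solve 2 (λ m d → d :* d :+ m :* d := d :* (m :+ d)) refl m d ⟩
        d ℕ.* (m + d)      ≤⟨ *-monoʳ-≤ d le ⟩
        d ℕ.* length H     ≤⟨ clipped-≥ le ⟩
        clipped m s        ∎)
        where
          open ≤-Reasoning
          open ℕSolver.+-*-Solver using (solve; con; _:+_; _:*_; _:=_)

      -- Only members of `H`, at most `m - d` of them, have values above `m - d`; this leaves the
      -- sum `d * d` short of the reference.
      fall-full : length H + d ℕ.≤ m → d ℕ.* d ℕ.≤ fall s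
      fall-full le = m+n≤o⇒m≤o∸n (d ℕ.* d) (begin
        d ℕ.* d + clipped (m ∸ d) s   ≤⟨ +-monoʳ-≤ (d ℕ.* d) (clipped-≤ (m+n≤o⇒m≤o∸n (length H) le)) ⟩
        d ℕ.* d + d ℕ.* length H      ≡⟨ solve 2 (λ h d → d :* d :+ d :* h := (h :+ d) :* d) refl (length H) d ⟩
        (length H + d) ℕ.* d          ≤⟨ *-monoˡ-≤ d le ⟩
        m ℕ.* d                       ∎)
        where
          open ≤-Reasoning
          open ℕSolver.+-*-Solver using (solve; con; _:+_; _:*_; _:=_)

      -- Source of the factor 9 in `potential`: a phase ends with `length H ≤ 9 * d`, so
      -- `9 * (d * d)` covers the restart.
      full-potential : length H ℕ.≤ 9 ℕ.* d → d ℕ.* d ℕ.≤ rise s + fall s → d ℕ.* length H ℕ.≤ potential s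
      full-potential H≤ full = begin
        d ℕ.* length H            ≤⟨ *-monoʳ-≤ d H≤ ⟩
        d ℕ.* (9 ℕ.* d)           ≡⟨ solve 1 (λ d → d :* (con 9 :* d) := con 9 :* (d :* d)) refl d ⟩
        9 ℕ.* (d ℕ.* d)           ≤⟨ *-monoʳ-≤ 9 full ⟩
        9 ℕ.* (rise s + fall s)   ≤⟨ m≤m+n _ _ ⟩
        potential s               ∎
        where
          open ≤-Reasoning
          open ℕSolver.+-*-Solver using (solve; con; _:+_; _:*_; _:=_)

    module _ {s op} (inv : Invariant s) (step : Step s op) where

      open State s
      open Invariant inv
      open Step step

      clipped-step : ∀ a → within1 (clipped a target) (clipped a s)
      clipped-step a = Clip.op-within1 a uniqueS valid (λ _ → clip-low a d z≤n)

      -- Only the set changes here, from `P` to `keptP`; `f` is already new. A removed element has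
      -- clipped value 0, so its weight falls from `d` to 0.
      removal-pays : length H ℕ.≤ m + d →
                     PWeight.weight keptP (newS S op) (newf f op) + d ℕ.* length removedP
                       ℕ.≤ PWeight.weight P (newS S op) (newf f op)
      removal-pays H≤ = sumOver-drop-⊆ d (removedP-unique inv step) (removedP-⊆ inv step) unchanged pays
        where
          f′ = newf f op
          low : ∀ {x} → x ∈ out → clip (m + d) d (f′ x) ≡ 0
          low i = clip-low (m + d) d (≤-trans (out-low rule i) H≤)
          pays : ∀ {x} → x ∈ removedP → pWeight keptP x (f′ x) + d ℕ.≤ pWeight P x (f′ x)
          pays {x} i with ∈-filter⁻ (_∈? P) {xs = out} i
          ... | x∈out , x∈P
            rewrite flipIf-no d (x ∈? keptP) (clip (m + d) d (f′ x)) (λ j → proj₂ (∈-∖⁻ P out j) x∈out)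
                  | flipIf-yes d (x ∈? P) (clip (m + d) d (f′ x)) x∈P
                  | low x∈out = ≤-refl
          unchanged : ∀ {x} → x ∈ newS S op → pWeight keptP x (f′ x) ℕ.≤ pWeight P x (f′ x)
          unchanged {x} _ with x ∈? P
          ... | no x∉P = ≤-reflexive (flipIf-no d (x ∈? keptP) _ (λ j → x∉P (proj₁ (∈-∖⁻ P out j))))
          ... | yes x∈P with x ∈? out
          ...   | no x∉out = ≤-reflexive (flipIf-yes d (x ∈? keptP) _ (∈-∖⁺ x∈P x∉out))
          ...   | yes x∈out
            rewrite flipIf-no d (x ∈? keptP) (clip (m + d) d (f′ x)) (λ j → proj₂ (∈-∖⁻ P out j) x∈out)
                  | low x∈out = z≤n

      -- An added element has value at least `2 * length H′`, hence clipped value `d`: its weight is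
      -- `d` outside `P` and 0 inside.
      addition-pays : (m + d) + d ℕ.≤ 2 ℕ.* length H′ →
                      membership target + d ℕ.* length addedP
                        ℕ.≤ PWeight.weight keptP (newS S op) (newf f op)
      addition-pays ≤2H′ = sumOver-drop-⊆ d (addedP-unique inv step)
                             (λ i → HInvariant.H⊆S (target-onH inv step) (addedP-⊆ inv step i)) unchanged pays
        where
          f′ = newf f op
          P′ = addedP ++ keptP
          pays : ∀ {x} → x ∈ addedP → pWeight P′ x (f′ x) + d ℕ.≤ pWeight keptP x (f′ x)
          pays {x} i with ∈-filter⁻ (added? inv step) {xs = H′} i
          ... | _ , x∉kept , high
            rewrite flipIf-yes d (x ∈? P′) (clip (m + d) d (f′ x)) (∈-++⁺ˡ i)
                  | flipIf-no d (x ∈? keptP) (clip (m + d) d (f′ x)) x∉kept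
                  | clip-high (m + d) d (≤-trans ≤2H′ high)
                  | n∸n≡0 d = ≤-refl
          unchanged : ∀ {x} → x ∈ newS S op → pWeight P′ x (f′ x) ℕ.≤ pWeight keptP x (f′ x)
          unchanged {x} _ with x ∈? addedP
          ... | yes i = ≤-trans (m≤m+n _ d) (pays i)
          ... | no x∉added with x ∈? keptP
          ...   | yes j = ≤-reflexive (flipIf-yes d (x ∈? P′) _ (∈-++⁺ʳ addedP j))
          ...   | no x∉kept = ≤-reflexive (flipIf-no d (x ∈? P′) _ (λ k → neither (∈-++⁻ addedP k)))
            where
              neither : ¬ (x ∈ addedP ⊎ x ∈ keptP)
              neither (inj₁ i) = x∉added i
              neither (inj₂ j) = x∉kept j

      membership-step : length H ℕ.≤ m + d → (m + d) + d ℕ.≤ 2 ℕ.* length H′ →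
                        d ℕ.* changes + membership target ℕ.≤ suc (membership s)
      membership-step H≤ ≤2H′ = begin
        -- In time order the chain is read from its end: `f` changes with `P` fixed, then elements
        -- leave, then elements join.
        d ℕ.* (a + r) + q             ≡⟨ solve 4 (λ d a r q → d :* (a :+ r) :+ q := (q :+ d :* a) :+ d :* r) refl d a r q ⟩
        (q + d ℕ.* a) + d ℕ.* r       ≤⟨ +-monoˡ-≤ (d ℕ.* r) (addition-pays ≤2H′) ⟩
        PWeight.weight keptP S′ f′ + d ℕ.* r ≤⟨ removal-pays H≤ ⟩
        PWeight.weight P S′ f′        ≤⟨ proj₁ (PWeight.op-within1 P uniqueS valid vanish) ⟩
        suc (membership s)            ∎
        where
          open ≤-Reasoning
          open ℕSolver.+-*-Solver using (solve; con; _:+_; _:*_; _:=_)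
          a = length addedP
          r = length removedP
          q = membership target
          S′ = newS S op
          f′ = newf f op
          -- A member of `P` lies in `H` and has positive value, so it is neither inserted nor
          -- deleted.
          vanish : ∀ {x} → (x ∈ S → f x ≡ 0) → pWeight P x 0 ≡ 0
          vanish {x} z = trans (flipIf-no d (x ∈? P) _ (λ x∈P → zero∉H onH (z (H⊆S (P⊆H x∈P))) (P⊆H x∈P)))
                               (clip-low (m + d) d z≤n)

      potential-step : length H ℕ.≤ m + d → (m + d) + d ℕ.≤ 2 ℕ.* length H′ →
                       d ℕ.* changes + potential target ℕ.≤ potential s + 19
      potential-step H≤ ≤2H′ = begin
        c + (9 ℕ.* (rise target + fall target) + membership target)
          ≡⟨ solve 3 (λ c u q → c :+ (u :+ q) := u :+ (c :+ q)) refl c _ (membership target) ⟩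
        9 ℕ.* (rise target + fall target) + (c + membership target)
          ≤⟨ +-mono-≤ (*-monoʳ-≤ 9 (+-mono-≤ (∸-within1ˡ (m ℕ.* d) (proj₁ (clipped-step m)))
                                             (∸-within1ʳ (m ℕ.* d) (proj₂ (clipped-step (m ∸ d))))))
                      (membership-step H≤ ≤2H′) ⟩
        -- `19 = 9 + 9 + 1`: `rise`, `fall` and `membership` each grow by at most one.
        9 ℕ.* (suc (rise s) + suc (fall s)) + suc (membership s)
          ≡⟨ solve 3 (λ u v q → con 9 :* ((con 1 :+ u) :+ (con 1 :+ v)) :+ (con 1 :+ q)
                             := (con 9 :* (u :+ v) :+ q) :+ con 19) refl (rise s) (fall s) (membership s) ⟩
        potential s + 19 ∎
        where
          open ≤-Reasoning
          open ℕSolver.+-*-Solver using (solve; con; _:+_; _:*_; _:=_)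
          c = d ℕ.* changes

  -- Phases of the amortisation.

  -- In Phase s N d the potential of s is N / d.
  data Phase (s : State) : ℕ → ℕ → Set where
    small : length (State.H s) < 4 → Phase s (length (State.P s)) 1
    large : ∀ {m d} → 0 < d → 4 ℕ.* d ℕ.≤ m → m ℕ.≤ 8 ℕ.* d →
            m < length (State.H s) + d → length (State.H s) < m + d →
            Phase s (Potential.potential m d s) d

  Phase-pos : ∀ {s N d} → Phase s N d → 0 < d
  Phase-pos (small _)           = s≤s z≤n
  Phase-pos (large 0<d _ _ _ _) = 0<d

  -- With the current size as base the drift terms vanish, leaving at most `d` for each member of
  -- `H`. Below 4, `P ⊆ H` suffices.
  fresh-phase : ∀ {s} → Invariant s →
                ∃[ N ] ∃[ d ] (Phase s N d × N ℕ.≤ d ℕ.* length (State.H s))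
  fresh-phase {s} inv with length (State.H s) <? 4
  ... | yes h<4 = length (State.P s) , 1 , small h<4 ,
    ≤-trans (Unique-⊆⇒length≤ uniqueP P⊆H) (≤-reflexive (sym (*-identityˡ _)))
    where open Invariant inv
  ... | no h≮4 = Potential.potential h d s , d ,
    large 0<d 4d≤h h≤8d (m<m+n h 0<d) (m<m+n h 0<d) ,
    Potential.fresh-potential h d inv refl (≤-trans (m≤n*m d 4) 4d≤h)
    where
      h = length (State.H s)
      -- Positive since `4 ≤ h`. Rounding down loses less than 4, and `4 ≤ 4 * d`, whence
      -- `h ≤ 8 * d`.
      d = h DivMod./ 4
      0<d : 0 < d
      0<d = m≥n⇒m/n>0 (≮⇒≥ h≮4)
      4d≤h : 4 ℕ.* d ℕ.≤ h
      4d≤h = ≤-trans (≤-reflexive (*-comm 4 d)) (m/n*n≤m h 4)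
      h≤8d : h ℕ.≤ 8 ℕ.* d
      h≤8d = begin
        h                      ≡⟨ m≡m%n+[m/n]*n h 4 ⟩
        h % 4 + d ℕ.* 4        ≤⟨ +-monoˡ-≤ (d ℕ.* 4) (<⇒≤ (m%n<n h 4)) ⟩
        4 + d ℕ.* 4            ≤⟨ +-monoˡ-≤ (d ℕ.* 4) (*-monoˡ-≤ 4 0<d) ⟩
        d ℕ.* 4 + d ℕ.* 4      ≡⟨ solve 1 (λ d → d :* con 4 :+ d :* con 4 := con 8 :* d) refl d ⟩
        8 ℕ.* d                ∎
        where
          open ≤-Reasoning
          open ℕSolver.+-*-Solver using (solve; con; _:+_; _:*_; _:=_)

  -- X / d is the potential after the step; unless the phase goes on, it is at least |H′|,
  -- which bounds the potential of a fresh phase.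
  record Amortised {s op} (N d : ℕ) (step : Step s op) : Set where
    open Step step
    field
      X k       : ℕ
      amortised : d ℕ.* changes + X ℕ.≤ N + k
      charge    : k ℕ.* length H′ ℕ.≤ 171 ℕ.* d
      no-charge : length H′ ≡ 0 → k ≡ 0
      onward    : Phase target X d ⊎ d ℕ.* length H′ ℕ.≤ X

  phase-step : ∀ {s op N d} → Invariant s → Phase s N d → (step : Step s op) → Amortised N d step
  phase-step {s} inv (small h<4) step with length (Step.H′ step) <? 4
  ... | yes h′<4 = record
    -- `k` is a multiple of `h′` rather than a constant, so that it vanishes with `h′`.
    { X = length (State.P target) ; k = 2 ℕ.* h′
    ; amortised = ≤-trans (≤-reflexive (cong (ℕ._+ length (State.P target)) (*-identityˡ changes))) (changes-≤ inv step)
    ; charge = ≤-trans (*-mono-≤ (*-monoʳ-≤ 2 (<⇒≤ h′<4)) (<⇒≤ h′<4)) (≤ᵇ⇒≤ 32 171 _)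
    ; no-charge = λ h′≡0 → cong (2 ℕ.*_) h′≡0
    ; onward = inj₁ (small h′<4)
    }
    where
      open Step step
      h′ = length H′
  ... | no _ = record
    -- The size has just reached 4. `X` is what a fresh phase may need, and the third `h′` in `k`
    -- pays for it.
    { X = h′ ; k = 3 ℕ.* h′
    ; amortised = begin
        1 ℕ.* changes + h′        ≡⟨ cong (ℕ._+ h′) (*-identityˡ changes) ⟩
        changes + h′              ≤⟨ +-monoˡ-≤ h′ (m+n≤o⇒m≤o changes (changes-≤ inv step)) ⟩
        (p + 2 ℕ.* h′) + h′       ≡⟨ solve 2 (λ p h → (p :+ con 2 :* h) :+ h := p :+ con 3 :* h) refl p h′ ⟩
        p + 3 ℕ.* h′              ∎
    ; charge = ≤-trans (*-mono-≤ (*-monoʳ-≤ 3 h′≤4) h′≤4) (≤ᵇ⇒≤ 48 171 _)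
    ; no-charge = λ h′≡0 → cong (3 ℕ.*_) h′≡0
    ; onward = inj₂ (≤-reflexive (*-identityˡ h′))
    }
    where
      open Step step
      open ≤-Reasoning
      open ℕSolver.+-*-Solver using (solve; con; _:+_; _:*_; _:=_)
      h′ = length H′
      p = length (State.P s)
      h′≤4 : h′ ℕ.≤ 4
      h′≤4 = ≤-trans (proj₁ (size-within1 (Invariant.uniqueH inv) rule)) h<4
  phase-step {s} inv (large {m} {d} 0<d 4d≤m m≤8d m<h+d h<m+d) step = record
    { X = potential target ; k = 19
    ; amortised = potential-step inv step (<⇒≤ h<m+d) m+2d≤2h′
    -- `171 = 19 * 9`, from `h′ ≤ 9 * d`.
    ; charge = ≤-trans (*-monoʳ-≤ 19 h′≤9d) (≤-reflexive (sym (*-assoc 19 9 d)))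
    ; no-charge = λ h′≡0 → ⊥-elim (<⇒≱ 0<d (≤-trans (m≤n+m d (m + d))
        (≤-trans m+2d≤2h′ (≤-reflexive (cong (2 ℕ.*_) h′≡0)))))
    ; onward = continue (m <? h′ + d) (h′ <? m + d)
    }
    where
      open Step step
      open Potential m d
      h′ = length H′
      sizes = size-within1 (Invariant.uniqueH inv) rule
      inv′ = target-Invariant inv step
      -- The strict bounds in `large` leave one unit of slack, so even the operation that ends the
      -- phase meets the bounds non-strictly and is paid for like the others.
      h′≤m+d : h′ ℕ.≤ m + d
      h′≤m+d = ≤-trans (proj₁ sizes) h<m+d
      m≤h′+d : m ℕ.≤ h′ + d
      m≤h′+d = ℕ.s≤s⁻¹ (≤-trans m<h+d (+-monoˡ-≤ d (proj₂ sizes)))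
      h′≤9d : h′ ℕ.≤ 9 ℕ.* d
      h′≤9d = ≤-trans h′≤m+d (≤-trans (+-monoˡ-≤ d m≤8d) (≤-reflexive (+-comm (8 ℕ.* d) d)))
      -- `4 * d ≤ m` is what makes `2 * (m - d)` at least `m + 2 * d`.
      m+2d≤2h′ : (m + d) + d ℕ.≤ 2 ℕ.* h′
      m+2d≤2h′ = +-cancelʳ-≤ (2 ℕ.* d) _ _ (begin
        ((m + d) + d) + 2 ℕ.* d   ≡⟨ solve 2 (λ m d → ((m :+ d) :+ d) :+ con 2 :* d := m :+ con 4 :* d) refl m d ⟩
        m + 4 ℕ.* d               ≤⟨ +-monoʳ-≤ m 4d≤m ⟩
        m + m                     ≤⟨ +-mono-≤ m≤h′+d m≤h′+d ⟩
        (h′ + d) + (h′ + d)       ≡⟨ solve 2 (λ h d → (h :+ d) :+ (h :+ d) := con 2 :* h :+ con 2 :* d) refl h′ d ⟩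
        2 ℕ.* h′ + 2 ℕ.* d        ∎)
        where
          open ≤-Reasoning
          open ℕSolver.+-*-Solver using (solve; con; _:+_; _:*_; _:=_)
      continue : Dec (m < h′ + d) → Dec (h′ < m + d) →
                 Phase target (potential target) d ⊎ d ℕ.* h′ ℕ.≤ potential target
      continue (yes lower) (yes upper) = inj₁ (large 0<d 4d≤m m≤8d lower upper)
      continue (yes _) (no h′≮) = inj₂ (full-potential inv′ h′≤9d
        (≤-trans (rise-full inv′ (≮⇒≥ h′≮)) (m≤m+n (rise target) (fall target))))
      continue (no m≮) _ = inj₂ (full-potential inv′ h′≤9d
        (≤-trans (fall-full inv′ (≮⇒≥ m≮)) (m≤n+m (fall target) (rise target))))

  -- Summation over a run.

  laterReciprocals : ∀ {s σ} → Run s σ → ℚ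
  laterReciprocals []           = 0ℚ
  laterReciprocals (step ∷ run) = reciprocal (length (Step.H′ step)) ℚ.+ laterReciprocals run

  -- By `length-isHIndex` the given indices are the sizes of `H`. The first term stands apart
  -- because each operation is charged to the state it produces.
  sumReciprocals-states : ∀ {s σ hs} → Invariant s → (run : Run s σ) → Pointwise HIndexOf (states run) hs →
                          sumReciprocals hs ≡ reciprocal (length (State.H s)) ℚ.+ laterReciprocals run
  sumReciprocals-states inv [] (isH ∷ []) rewrite length-isHIndex (Invariant.onH inv) isH = refl
  sumReciprocals-states {hs = h ∷ _} inv (step ∷ run) (isH ∷ isHs) rewrite length-isHIndex (Invariant.onH inv) isH =
    cong (reciprocal h ℚ.+_) (sumReciprocals-states (target-Invariant inv step) run isHs)

  -- Stated for an arbitrary phase, so that the induction can go on in the old phase or in a fresh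
  -- one.
  totalChanges-≤ : ∀ {s σ N d} → Invariant s → Phase s N d → (run : Run s σ) →
                   ι (totalChanges run) ≤ N per d ℚ.+ ι 171 * laterReciprocals run
  totalChanges-≤ {N = N} {d} inv phase [] =
    subst (_≤ N per d ℚ.+ ι 171 * 0ℚ) (sym (ι-def 0)) (subst (λ q → 0ℚ ≤ N per d ℚ.+ q) (sym (ℚ.*-zeroʳ (ι 171)))
      (ℚ.≤-trans (per-nonNeg N d) (ℚ.≤-reflexive (sym (ℚ.+-identityʳ (N per d))))))
  totalChanges-≤ {N = N} {d} inv phase (step ∷ run) =
    subst (_≤ N per d ℚ.+ ι 171 * laterReciprocals (step ∷ run))
      (sym (ι-+ changes (totalChanges run))) (conclude onward)
    where
      open Step step
      open Amortised (phase-step inv phase step)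
      inv′ = target-Invariant inv step

      via : ∀ {N₁ d₁} → Phase target N₁ d₁ → N₁ per d₁ ≤ X per d →
            ι changes ℚ.+ ι (totalChanges run) ≤ N per d ℚ.+ ι 171 * laterReciprocals (step ∷ run)
      via {N₁} {d₁} phase₁ le =
        telescope (ι 171) (ι changes) (ι (totalChanges run)) (N₁ per d₁) (X per d) (N per d)
          (reciprocal (length H′)) (laterReciprocals run)
          (totalChanges-≤ inv′ phase₁ run) le
          (amortised-per 171 {changes} {d} {k} {length H′} {N} {X} (Phase-pos phase) amortised charge no-charge)

      conclude : Phase target X d ⊎ d ℕ.* length H′ ℕ.≤ X →
                 ι changes ℚ.+ ι (totalChanges run) ≤ N per d ℚ.+ ι 171 * laterReciprocals (step ∷ run)
      conclude (inj₁ phase₁) = via phase₁ (ℚ.≤-refl {X per d})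
      conclude (inj₂ full) with fresh-phase inv′
      ... | N₁ , d₁ , phase₁ , N₁≤ =
        via phase₁ (per-full {N₁} {d₁} {length H′} {d} (Phase-pos phase₁) (Phase-pos phase) N₁≤ full)

theorem2 : ∃[ C ] ((A : Set) (_≟_ : DecidableEquality A) → let open Maintenance _≟_ in
    (σ : List (Op A)) (run : Run start σ) (hs : List ℕ) →
    Pointwise HIndexOf (states run) hs →
    (+ totalChanges run) / 1 ≤ ((+ C) / 1) * sumReciprocals hs)
theorem2 = 171 , λ A _≟_ σ run hs isHs →
  let open Amortisation _≟_
      open Maintenance _≟_
      open ℚ.≤-Reasoning
      later = laterReciprocals run
  in begin
    + totalChanges run / 1            ≡⟨ ι-def (totalChanges run) ⟨
    -- The empty start is in the small phase, with potential `length P = 0`.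
    ι (totalChanges run)              ≤⟨ totalChanges-≤ start-Invariant (small (s≤s z≤n)) run ⟩
    0 per 1 ℚ.+ ι 171 * later         ≡⟨ cong (ℚ._+ ι 171 * later) (0-per 1) ⟩
    0ℚ ℚ.+ ι 171 * later              ≡⟨ ℚ.+-identityˡ (ι 171 * later) ⟩
    ι 171 * later                     ≡⟨ cong (ι 171 *_) (ℚ.+-identityˡ later) ⟨
    -- The initial state has h-index 0 and contributes `reciprocal 0`, which is 0.
    ι 171 * (reciprocal 0 ℚ.+ later)  ≡⟨ cong (ι 171 *_) (sumReciprocals-states start-Invariant run isHs) ⟨
    ι 171 * sumReciprocals hs         ≡⟨ cong (_* sumReciprocals hs) (ι-def 171) ⟩
    (+ 171 / 1) * sumReciprocals hs   ∎
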